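{- For every integer $t\ge 0$, if $G$ is a $t$-dominating graph, then there is a $0$-dominating graph $H$ with $V(H)=V(G)$ such that the local difference between $G$ and $H$ is at most $646t^4$.
   Context: All graphs are finite and have no loops or parallel edges. A vertex $u$ of a graph $t$-dominates a vertex $v$ if there are at most $t$ vertices different from $u,v$ that are adjacent to $v$ and not adjacent to $u$. A graph is $t$-dominating if for every pair of distinct vertices, one of them $t$-dominates the other. For graphs $G,H$ on the same vertex set, the local difference between $G$ and $H$ is the maximum over all vertices $v$ of $|N_G(v)\setminus N_H(v)|+|N_H(v)\setminus N_G(v)|$, where $N_G(v),N_H(v)$ denote the sets of neighbours of $v$ in $G,H$ respectively. -}

module Defs where

open import Data.Bool.Base using (Bool; false)
open import Data.Fin.Base using (Fin)
open import Data.Fin.Subset using (Subset; _─_; _-_; ∣_∣)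
open import Data.List.Base using (map; allFin)
open import Data.List.Extrema.Nat using (max)
open import Data.Nat.Base using (ℕ; _+_; _≤_)
open import Data.Sum.Base using (_⊎_)
open import Data.Vec.Base using (tabulate)
open import Relation.Binary.PropositionalEquality using (_≡_; _≢_)

-- Finite simple graphs with vertex set Fin n.  Boolean adjacency makes
-- neighbourhoods elements of Subset n, so their cardinalities are computable.
record Graph (n : ℕ) : Set where
  field
    adj    : Fin n → Fin n → Bool
    sym    : ∀ u v → adj u v ≡ adj v u
    irrefl : ∀ v → adj v v ≡ false

open Graph public using (adj)

neighbours : ∀ {n} → Graph n → Fin n → Subset n
neighbours G v = tabulate (adj G v)

Dominates : ∀ {n} → Graph n → ℕ → Fin n → Fin n → Set
Dominates G t u v = ∣ neighbours G v ─ neighbours G u - u - v ∣ ≤ t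

Dominating : ∀ {n} → ℕ → Graph n → Set
Dominating t G = ∀ u v → u ≢ v → Dominates G t u v ⊎ Dominates G t v u

-- The local difference is 0 when there are no vertices.
localDifference : ∀ {n} → Graph n → Graph n → ℕ
localDifference {n} G H = max 0 (map differenceAt (allFin n))
  where
  differenceAt : Fin n → ℕ
  differenceAt v = ∣ neighbours G v ─ neighbours H v ∣
                 + ∣ neighbours H v ─ neighbours G v ∣

module Submission where

-- Order the vertices by degree: then for w ≼ x all but at most D = t + 2 neighbours of w are
-- neighbours of x.  Peel off vertices one by one, making each removed y adjacent in H either
-- to everything that remains ("top") or to nothing that remains ("bottom"); such an H is
-- 0-dominating.  A top y is chosen to be a neighbour of the lowest remaining vertex with at
-- most 2D remaining non-neighbours, a bottom dually; double counting provides one unless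
-- the lowest or highest remaining vertex itself can be removed.
-- The errors at x made after 2D tops missing x are few: at that time, double counting the
-- non-adjacent pairs formed by these tops and by the remaining w ≼ x leaves at most 4D such w,
-- and each later top missing x lies in N(w) ∖ N(x) for one of them, the lowest vertex of its
-- moment.  Hence at most 2D + 4D² tops are wrong at x, and dually for bottoms.

open import Defs
open import Data.Bool.Base using (Bool; true; false; not; _∧_; _∨_; _xor_; if_then_else_)
open import Data.Bool.Properties
  using ( _≟_; not-involutive; ∧-comm; ∧-conicalˡ; ∧-conicalʳ; ∧-identityʳ; ∧-inverseʳ; ∧-zeroʳ; ∨-zeroʳ
        ; xor-comm; xor-identityʳ; xor-same)
open import Data.Empty using (⊥; ⊥-elim)
open import Data.Fin.Base using (Fin; zero; suc)
import Data.Fin.Properties as Fin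
open import Data.Fin.Subset using (Subset; _─_; _-_; ∣_∣; ⁅_⁆)
open import Data.List.Extrema.Nat using (max≤v⁺)
open import Data.List.Relation.Unary.All.Properties using (map⁺; tabulate⁺)
open import Data.Nat.Base
  using (ℕ; zero; suc; _+_; _*_; _^_; _≤_; _<_; z≤n; s≤s; NonZero; s≤s⁻¹; >-nonZero; >-nonZero⁻¹)
open import Data.Nat.Properties
  using ( ≤-refl; ≤-reflexive; ≤-trans; ≤-total; _≤?_; <-≤-trans; n≮0; <-irrefl; ≰⇒>; +-mono-≤
        ; +-mono-≤-<; +-mono-<-≤; +-monoˡ-≤; +-monoʳ-≤; +-cancelʳ-≤; +-cancelˡ-≤; +-identityʳ
        ; +-suc; m≤m+n; m≤n+m; *-mono-≤; *-monoˡ-≤; *-monoʳ-≤; *-monoʳ-<; *-cancelˡ-≤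
        ; *-identityˡ; *-distribʳ-+; ^-monoʳ-≤; +-*-semiring; module ≤-Reasoning)
open import Algebra.Properties.Semiring.Sum +-*-semiring
  using (sum; sum-syntax; ∑-comm; ∑-distrib-+; sum-cong-≗; sum-replicate-zero; *-distribʳ-sum)
open import Data.Nat.Tactic.RingSolver using (solve-∀)
open import Data.Product.Base using (Σ-syntax; ∃-syntax; _×_; _,_; proj₁; proj₂)
open import Data.Sum.Base using (_⊎_; inj₁; inj₂)
open import Data.Vec.Base using (_∷_; []; lookup)
open import Data.Vec.Properties using (lookup∘tabulate; lookup-replicate)
open import Function.Base using (_∘_; flip)
open import Relation.Binary.Definitions using (Decidable; Total; Transitive)
open import Relation.Binary.PropositionalEquality
  using (_≡_; _≢_; refl; sym; trans; cong; cong₂; subst)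
open import Relation.Nullary.Decidable using (does; yes; no; dec-true; dec-false)
open import Relation.Nullary.Negation.Core using (contradiction)

private
  variable
    m n : ℕ

-- Counting

∑-mono : {f g : Fin n → ℕ} → (∀ i → f i ≤ g i) → sum f ≤ sum g
∑-mono {zero}  f≤g = z≤n
∑-mono {suc n} f≤g = +-mono-≤ (f≤g zero) (∑-mono (f≤g ∘ suc))

∑-mono-< : {f g : Fin n → ℕ} → (∀ i → f i ≤ g i) → ∀ j → f j < g j → sum f < sum g
∑-mono-< f≤g zero    fj<gj = +-mono-<-≤ fj<gj (∑-mono (f≤g ∘ suc))
∑-mono-< f≤g (suc j) fj<gj = +-mono-≤-< (f≤g zero) (∑-mono-< (f≤g ∘ suc) j fj<gj)

Pred : ℕ → Set
Pred n = Fin n → Bool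

infix 4 _∈_ _⊆_

_∈_ : Fin n → Pred n → Set
i ∈ p = p i ≡ true

_⊆_ : Pred n → Pred n → Set
p ⊆ q = ∀ {i} → i ∈ p → i ∈ q

⟦_⟧ : Bool → ℕ
⟦ true  ⟧ = 1
⟦ false ⟧ = 0

⟦⟧≤1 : ∀ b → ⟦ b ⟧ ≤ 1
⟦⟧≤1 true  = ≤-refl
⟦⟧≤1 false = z≤n

⟦⟧-mono : ∀ {b c} → (b ≡ true → c ≡ true) → ⟦ b ⟧ ≤ ⟦ c ⟧
⟦⟧-mono {false}         _ = z≤n
⟦⟧-mono {true}  {true}  _ = ≤-refl
⟦⟧-mono {true}  {false} h with () ← h refl

∧-true : ∀ {b c} → b ≡ true → c ≡ true → b ∧ c ≡ true
∧-true refl refl = refl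

if-mono : ∀ c {b d e} → (d ≡ true → e ≡ true) →
          (if c then b else d) ≡ true → (if c then b else e) ≡ true
if-mono true  _ h = h
if-mono false f h = f h

-- Opacity lets unification recover p from # p.
opaque
  # : Pred n → ℕ
  # {n} p = ∑[ i < n ] ⟦ p i ⟧

  #-mono : {p q : Pred n} → p ⊆ q → # p ≤ # q
  #-mono p⊆q = ∑-mono λ i → ⟦⟧-mono (p⊆q {i})

  #-mono-< : {p q : Pred n} → p ⊆ q → ∀ {j} → j ∈ q → p j ≡ false → # p < # q
  #-mono-< {p = p} {q} p⊆q {j} j∈q j∉p = ∑-mono-< (λ i → ⟦⟧-mono (p⊆q {i})) j lt
    where
    lt : ⟦ p j ⟧ < ⟦ q j ⟧
    lt rewrite j∈q | j∉p = ≤-refl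

  #-empty : {p : Pred n} → (∀ i → p i ≡ false) → # p ≡ 0
  #-empty {n} p∅ = trans (sum-cong-≗ λ i → cong ⟦_⟧ (p∅ i)) (sum-replicate-zero n)

  -- The index `j` costs no more than its own indicator. In the induction over removals this
  -- isolates the error charged to the vertex just removed.
  #-mono-except : ∀ (p q : Pred n) j → (∀ {i} → i ≢ j → i ∈ p → i ∈ q) → # p ≤ ⟦ p j ⟧ + # q
  #-mono-except p q zero    h = +-monoʳ-≤ ⟦ p zero ⟧ (≤-trans (#-mono {p = p ∘ suc} (h λ ())) (m≤n+m (# (q ∘ suc)) ⟦ q zero ⟧))
  #-mono-except p q (suc j) h = begin
    ⟦ p zero ⟧ + # (p ∘ suc)                     ≤⟨ +-mono-≤ (⟦⟧-mono (h λ ())) (#-mono-except (p ∘ suc) (q ∘ suc) j λ i≢j → h (i≢j ∘ Fin.suc-injective)) ⟩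
    ⟦ q zero ⟧ + (⟦ p (suc j) ⟧ + # (q ∘ suc))   ≡⟨ swap ⟦ q zero ⟧ ⟦ p (suc j) ⟧ _ ⟩
    ⟦ p (suc j) ⟧ + (⟦ q zero ⟧ + # (q ∘ suc))   ∎
    where
    open ≤-Reasoning
    swap : ∀ a b c → a + (b + c) ≡ b + (a + c)
    swap = solve-∀

  #-split : ∀ (p q : Pred n) → # p ≡ # (λ i → p i ∧ q i) + # (λ i → p i ∧ not (q i))
  #-split p q = trans (sum-cong-≗ λ i → split (p i) (q i)) (∑-distrib-+ (λ i → ⟦ p i ∧ q i ⟧) (λ i → ⟦ p i ∧ not (q i) ⟧))
    where
    split : ∀ b c → ⟦ b ⟧ ≡ ⟦ b ∧ c ⟧ + ⟦ b ∧ not c ⟧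
    split false c     = refl
    split true  true  = refl
    split true  false = refl

  ∑-⟦⟧*-≤ : ∀ (p : Pred n) (f : Fin n → ℕ) c → (∀ {i} → i ∈ p → f i ≤ c) →
            ∑[ i < n ] (⟦ p i ⟧ * f i) ≤ # p * c
  ∑-⟦⟧*-≤ p f c h = ≤-trans (∑-mono pointwise) (≤-reflexive (sym (*-distribʳ-sum c (⟦_⟧ ∘ p))))
    where
    pointwise : ∀ i → ⟦ p i ⟧ * f i ≤ ⟦ p i ⟧ * c
    pointwise i with p i in eq
    ... | true  = *-monoʳ-≤ 1 (h eq)
    ... | false = z≤n

  ∑-guard : ∀ b (p : Pred n) → ∑[ i < n ] ⟦ b ∧ p i ⟧ ≡ ⟦ b ⟧ * # p
  ∑-guard true  p = sym (*-identityˡ (# p))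
  ∑-guard {n} false p = sum-replicate-zero n

  -- A pair of `P` and `Q` either satisfies `R`, and is charged to its row at a cost of at most `A`,
  -- or fails `R`, and is charged to its column at a cost of at most `B`.
  double-count : ∀ (P : Pred m) (Q : Pred n) (R : Fin m → Fin n → Bool) A B →
                 (∀ {p} → p ∈ P → # (λ q → Q q ∧ R p q) ≤ A) →
                 (∀ {q} → q ∈ Q → # (λ p → P p ∧ not (R p q)) ≤ B) →
                 # P * # Q ≤ # P * A + # Q * B
  double-count {m} {n} P Q R A B hA hB = begin
    # P * # Q
      ≡⟨ *-distribʳ-sum (# Q) (⟦_⟧ ∘ P) ⟩
    ∑[ p < m ] (⟦ P p ⟧ * # Q)
      ≤⟨ ∑-mono (λ p → row p) ⟩
    -- The guard `Q q` stands in front so that `∑-guard` can pull it out of the inner sum once the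
    -- sums are exchanged.
    ∑[ p < m ] (⟦ P p ⟧ * A + ∑[ q < n ] ⟦ Q q ∧ (P p ∧ not (R p q)) ⟧)
      ≡⟨ ∑-distrib-+ (λ p → ⟦ P p ⟧ * A) _ ⟩
    ∑[ p < m ] (⟦ P p ⟧ * A) + ∑[ p < m ] ∑[ q < n ] ⟦ Q q ∧ (P p ∧ not (R p q)) ⟧
      ≡⟨ cong₂ _+_ (sym (*-distribʳ-sum A (⟦_⟧ ∘ P))) (∑-comm λ p q → ⟦ Q q ∧ (P p ∧ not (R p q)) ⟧) ⟩
    # P * A + ∑[ q < n ] ∑[ p < m ] ⟦ Q q ∧ (P p ∧ not (R p q)) ⟧
      ≡⟨ cong (# P * A +_) (sum-cong-≗ λ q → ∑-guard (Q q) (λ p → P p ∧ not (R p q))) ⟩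
    # P * A + ∑[ q < n ] (⟦ Q q ⟧ * # (λ p → P p ∧ not (R p q)))
      ≤⟨ +-monoʳ-≤ (# P * A) (∑-⟦⟧*-≤ Q _ B hB) ⟩
    # P * A + # Q * B ∎
    where
    open ≤-Reasoning
    row : ∀ p → ⟦ P p ⟧ * # Q ≤ ⟦ P p ⟧ * A + ∑[ q < n ] ⟦ Q q ∧ (P p ∧ not (R p q)) ⟧
    row p with P p in eq
    ... | false = z≤n
    ... | true  = begin
      1 * # Q                                                   ≡⟨ *-identityˡ _ ⟩
      # Q                                                       ≡⟨ #-split Q (R p) ⟩
      # (λ q → Q q ∧ R p q) + # (λ q → Q q ∧ not (R p q))       ≤⟨ +-monoˡ-≤ _ (hA eq) ⟩
      A + # (λ q → Q q ∧ not (R p q))                           ≡⟨ cong (_+ _) (sym (*-identityˡ A)) ⟩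
      1 * A + # (λ q → Q q ∧ not (R p q))                       ∎

-- Deleting and adding elements

_∖_ : Pred n → Fin n → Pred n
(S ∖ y) z = S z ∧ not (does (z Fin.≟ y))

∖⊆ : ∀ {S : Pred n} {y} → S ∖ y ⊆ S
∖⊆ {S = S} {i = z} = ∧-conicalˡ (S z) _

∈-∖ : ∀ {S : Pred n} {y z} → z ∈ S → z ≢ y → z ∈ S ∖ y
∈-∖ {y = y} {z} z∈S z≢y = ∧-true z∈S (cong not (dec-false (z Fin.≟ y) z≢y))

∖-self : ∀ (S : Pred n) y → (S ∖ y) y ≡ false
∖-self S y = trans (cong (λ b → S y ∧ not b) (dec-true (y Fin.≟ y) refl)) (∧-zeroʳ (S y))

insert : Pred n → Fin n → Pred n
insert Y y z = Y z ∨ does (z Fin.≟ y)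

⊆insert : ∀ (Y : Pred n) y → Y ⊆ insert Y y
⊆insert Y y {z} z∈Y = cong (_∨ does (z Fin.≟ y)) z∈Y

∈insert : ∀ (Y : Pred n) y → y ∈ insert Y y
∈insert Y y = trans (cong (Y y ∨_) (dec-true (y Fin.≟ y) refl)) (∨-zeroʳ (Y y))

insert⁻ : ∀ (Y : Pred n) y {z} → z ∈ insert Y y → z ∈ Y ⊎ z ≡ y
insert⁻ Y y {z} h with Y z | z Fin.≟ y
... | true  | _       = inj₁ refl
... | false | yes z≡y = inj₂ z≡y

reflexive : ∀ {_≼_ : Fin n → Fin n → Set} → Total _≼_ → ∀ {i} → i ≼ i
reflexive total {i} with total i i
... | inj₁ i≼i = i≼i
... | inj₂ i≼i = i≼i

least : ∀ {_≼_ : Fin n → Fin n → Set} → Total _≼_ → Transitive _≼_ → (S : Pred n) →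
        (∀ z → S z ≡ false) ⊎ (∃[ v ] v ∈ S × (∀ {x} → x ∈ S → v ≼ x))
least {zero}  total tr S = inj₁ λ ()
least {suc n} {_≼_} total tr S
  with S zero in eq | least {n} (λ i j → total (suc i) (suc j)) tr (S ∘ suc)
... | false | inj₁ ∅ = inj₁ λ { zero → eq ; (suc i) → ∅ i }
... | false | inj₂ (v , v∈S , v≼) = inj₂ (suc v , v∈S , λ { {zero} h → contradiction (trans (sym eq) h) λ () ; {suc i} h → v≼ h })
... | true  | inj₁ ∅ = inj₂ (zero , eq , λ { {zero} h → reflexive total ; {suc i} h → contradiction (trans (sym (∅ i)) h) λ () })
... | true  | inj₂ (v , v∈S , v≼) with total zero (suc v)
...   | inj₁ 0≼v = inj₂ (zero , eq , λ { {zero} h → reflexive total ; {suc i} h → tr 0≼v (v≼ h) })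
...   | inj₂ v≼0 = inj₂ (suc v , v∈S , λ { {zero} h → v≼0 ; {suc i} h → v≼ h })

-- Nested relations

-- Loops are permitted in `a`, since the complement of a loopless relation has all of them; this
-- keeps the notion closed under complementation.
record Nest (n D : ℕ) : Set₁ where
  field
    a       : Fin n → Fin n → Bool
    a-sym   : ∀ u v → a u v ≡ a v u
    _≼_     : Fin n → Fin n → Set
    ≼-total : Total _≼_
    ≼-trans : Transitive _≼_
    _≼?_    : Decidable _≼_
    nested  : ∀ {w x} → w ≼ x → # (λ z → a w z ∧ not (a x z)) ≤ D

-- Complementation reverses the order and exchanges tops and bottoms.
dual : ∀ {D} → Nest n D → Nest n D
dual N = record
  { a       = λ u v → not (a u v)
  ; a-sym   = λ u v → cong not (a-sym u v)
  ; _≼_     = flip _≼_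
  ; ≼-total = flip ≼-total
  ; ≼-trans = flip ≼-trans
  ; _≼?_    = flip _≼?_
  ; nested  = λ {w} {x} x≼w → ≤-trans (#-mono λ {z} → swap (a w z) (a x z)) (nested x≼w)
  }
  where
  open Nest N
  swap : ∀ b c → not b ∧ not (not c) ≡ true → c ∧ not b ≡ true
  swap false true _ = refl

-- Removable vertices

module _ {D : ℕ} (N : Nest n D) where
  open Nest N

  -- These are the possible tops. The neighbour `v` at the bottom of the order controls the errors
  -- at other vertices; the few non-neighbours control the errors at `y` itself and also serve as
  -- the row bound in `errors-late`.
  Removable : Pred n → Fin n → Set
  Removable S y = (∃[ v ] v ∈ S × a v y ≡ true × (∀ {x} → x ∈ S → v ≼ x))
                × # (λ z → S z ∧ not (a y z)) ≤ 2 * D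

  -- Take `y` highest among the neighbours `L` of `v`, and let `Z` be its non-neighbours in `S`.
  -- Each `l` in `L` lies below `y`, so it has at most `D` neighbours in `Z`; each `z` in `Z` lies
  -- above `v`, so it misses at most `D` members of `L`. Hence `L` and `Z` cannot both have more
  -- than `2 * D` elements.
  removable-neighbour : ∀ S {v} → v ∈ S → (∀ {x} → x ∈ S → v ≼ x) →
                        2 * D < # (λ z → S z ∧ a v z) → ∃[ y ] y ∈ S × Removable S y
  removable-neighbour S {v} v∈S v≼ big
    with least (flip ≼-total) (flip ≼-trans) (λ z → S z ∧ a v z)
  ... | inj₁ ∅ = contradiction (subst (2 * D <_) (#-empty ∅) big) n≮0
  ... | inj₂ (y , y∈L , ≼y) = y , ∧-conicalˡ (S y) _ y∈L , (v , v∈S , ∧-conicalʳ (S y) _ y∈L , v≼) , codegree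
    where
    L Z : Pred n
    L z = S z ∧ a v z
    Z z = S z ∧ not (a y z)

    rows : ∀ {l} → l ∈ L → # (λ z → Z z ∧ a l z) ≤ D
    rows {l} l∈L = ≤-trans (#-mono λ {z} → f (S z) (a y z) (a l z)) (nested (≼y l∈L))
      where
      f : ∀ b c d → (b ∧ not c) ∧ d ≡ true → d ∧ not c ≡ true
      f true false true _ = refl

    columns : ∀ {z} → z ∈ Z → # (λ l → L l ∧ not (a l z)) ≤ D
    columns {z} z∈Z = ≤-trans (#-mono λ {l} → g l) (nested (v≼ (∧-conicalˡ (S z) _ z∈Z)))
      where
      f : ∀ b c d → (b ∧ c) ∧ not d ≡ true → c ∧ not d ≡ true
      f true true false _ = refl
      g : ∀ l → L l ∧ not (a l z) ≡ true → a v l ∧ not (a z l) ≡ true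
      g l h rewrite a-sym z l = f (S l) (a v l) (a l z) h

    arith : ∀ p q → 2 * D < p → 2 * D < q → p * q ≤ p * D + q * D → ⊥
    arith p@(suc _) q@(suc _) 2D<p 2D<q h = <-irrefl refl (begin-strict
      2 * (p * q)                 ≤⟨ *-monoʳ-≤ 2 h ⟩
      2 * (p * D + q * D)         ≡⟨ e p q D ⟩
      p * (2 * D) + q * (2 * D)   <⟨ +-mono-<-≤ (*-monoʳ-< p 2D<q) (*-monoʳ-≤ q (≤-trans (m≤n+m _ 1) 2D<p)) ⟩
      p * q + q * p               ≡⟨ e′ p q ⟩
      2 * (p * q)                 ∎)
      where
      open ≤-Reasoning
      e : ∀ p q D → 2 * (p * D + q * D) ≡ p * (2 * D) + q * (2 * D)
      e = solve-∀
      e′ : ∀ p q → p * q + q * p ≡ 2 * (p * q)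
      e′ = solve-∀

    codegree : # Z ≤ 2 * D
    codegree with # Z ≤? 2 * D
    ... | yes h = h
    ... | no  h = ⊥-elim (arith (# L) (# Z) big (≰⇒> h) (double-count L Z a D D rows columns))

-- `true` stands for tops and `false` for bottoms: a bottom is a top of the complement, so arguments
-- need to be made for tops only.
side : ∀ {D} → Nest n D → Bool → Nest n D
side N true  = N
side N false = dual N

removable-exists : ∀ {D} (N : Nest n D) (S : Pred n) →
                   (∀ z → S z ≡ false) ⊎ (∃[ b ] ∃[ y ] y ∈ S × Removable (side N b) S y)
removable-exists {D = D} N S
  with least (Nest.≼-total N) (Nest.≼-trans N) S | least (flip (Nest.≼-total N)) (flip (Nest.≼-trans N)) S
... | inj₁ ∅ | _      = inj₁ ∅
... | inj₂ _ | inj₁ ∅ = inj₁ ∅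
... | inj₂ (v , v∈S , v≼) | inj₂ (u , u∈S , ≼u)
  with # (λ z → S z ∧ Nest.a N v z) ≤? 2 * D | # (λ z → S z ∧ not (Nest.a N u z)) ≤? 2 * D
... | no  h | _     = inj₂ (true , removable-neighbour N S v∈S v≼ (≰⇒> h))
... | yes _ | no  h = inj₂ (false , removable-neighbour (dual N) S u∈S ≼u (≰⇒> h))
-- Now the lowest vertex `v` has few neighbours and the highest vertex `u` few non-neighbours. If
-- they are adjacent, `u` is a top with witness `v`; otherwise `v` is a bottom with witness `u`.
... | yes h | yes h′ with Nest.a N v u in eq
...   | true  = inj₂ (true , u , u∈S , (v , v∈S , eq , v≼) , h′)
...   | false = inj₂ (false , v , v∈S ,
          (u , u∈S , cong not (trans (Nest.a-sym N u v) eq) , ≼u) ,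
          ≤-trans (#-mono λ {z} → subst (λ b → S z ∧ b ≡ true) (not-involutive _)) h)

-- Peeling and the threshold graph it defines

data Peel {D} (N : Nest n D) (S : Pred n) : Set where
  done : (∀ z → S z ≡ false) → Peel N S
  step : ∀ b y → y ∈ S → Removable (side N b) S y → Peel N (S ∖ y) → Peel N S

peel : ∀ {D} (N : Nest n D) S → Peel N S
peel {n} N S = go (suc (# S)) S ≤-refl
  where
  go : ∀ k S → # S < k → Peel N S
  go (suc k) S #S<k with removable-exists N S
  ... | inj₁ ∅ = done ∅
  ... | inj₂ (b , y , y∈S , r) =
    step b y y∈S r (go k (S ∖ y) (<-≤-trans (#-mono-< (∖⊆ {S = S}) y∈S (∖-self S y)) (s≤s⁻¹ #S<k)))

module _ {D} {N : Nest n D} where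

  -- Two distinct vertices are joined according to the type of whichever is removed first. With
  -- `xor`, a diagonal pair falls through every step to `done`, so no loops arise.
  threshold : ∀ {S} → Peel N S → Fin n → Fin n → Bool
  threshold (done _) u v = false
  threshold (step b y _ _ p) u v = if does (u Fin.≟ y) xor does (v Fin.≟ y) then b else threshold p u v

  threshold-sym : ∀ {S} (p : Peel N S) u v → threshold p u v ≡ threshold p v u
  threshold-sym (done _) u v = refl
  threshold-sym (step b y _ _ p) u v =
    cong₂ (if_then b else_) (xor-comm (does (u Fin.≟ y)) _) (threshold-sym p u v)

  threshold-irrefl : ∀ {S} (p : Peel N S) v → threshold p v v ≡ false
  threshold-irrefl (done _) v = refl
  threshold-irrefl (step b y _ _ p) v rewrite xor-same (does (v Fin.≟ y)) = threshold-irrefl p v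

  threshold-graph : ∀ {S} → Peel N S → Graph n
  threshold-graph p = record { adj = threshold p ; sym = threshold-sym p ; irrefl = threshold-irrefl p }

  -- A vertex removed before both `u` and `v` treats them alike. The first of the two to go then
  -- dominates the other if it is a top, and is dominated by it if it is a bottom.
  threshold-nested : ∀ {S} (p : Peel N S) {u v} → u ≢ v →
    (∀ w → w ≢ u → w ≢ v → threshold p v w ≡ true → threshold p u w ≡ true) ⊎
    (∀ w → w ≢ u → w ≢ v → threshold p u w ≡ true → threshold p v w ≡ true)
  threshold-nested (done _) u≢v = inj₁ λ _ _ _ ()
  threshold-nested (step b y _ _ p) {u} {v} u≢v with u Fin.≟ y | v Fin.≟ y
  threshold-nested (step b y _ _ p) u≢v | yes refl | yes refl = contradiction refl u≢v
  threshold-nested (step true y _ _ p) u≢v | yes refl | no _ = inj₁ f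
    where
    f : ∀ w → w ≢ y → _ → _ → (if not (does (w Fin.≟ y)) then true else threshold p y w) ≡ true
    f w w≢y _ _ rewrite dec-false (w Fin.≟ y) w≢y = refl
  threshold-nested (step false y _ _ p) {v = v} u≢v | yes refl | no _ = inj₂ f
    where
    f : ∀ w → w ≢ y → w ≢ v → (if not (does (w Fin.≟ y)) then false else threshold p y w) ≡ true → _
    f w w≢y _ h rewrite dec-false (w Fin.≟ y) w≢y with () ← h
  threshold-nested (step true y _ _ p) {u} u≢v | no _ | yes refl = inj₂ f
    where
    f : ∀ w → w ≢ u → w ≢ y → _ → (if not (does (w Fin.≟ y)) then true else threshold p y w) ≡ true
    f w _ w≢y _ rewrite dec-false (w Fin.≟ y) w≢y = refl
  threshold-nested (step false y _ _ p) {u} u≢v | no _ | yes refl = inj₁ f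
    where
    f : ∀ w → w ≢ u → w ≢ y → (if not (does (w Fin.≟ y)) then false else threshold p y w) ≡ true → _
    f w _ w≢y h rewrite dec-false (w Fin.≟ y) w≢y with () ← h
  threshold-nested (step b y _ _ p) {u} {v} u≢v | no _ | no _ with threshold-nested p u≢v
  ... | inj₁ h = inj₁ λ w w≢u w≢v → if-mono (does (w Fin.≟ y)) (h w w≢u w≢v)
  ... | inj₂ h = inj₂ λ w w≢u w≢v → if-mono (does (w Fin.≟ y)) (h w w≢u w≢v)

  -- Errors made by removals

  wrong : Bool → Fin n → Fin n → Bool
  wrong b y x = not (Nest.a (side N b) y x)

  -- Only removals before that of `x` count. Pairs of `x` with vertices surviving it are settled by
  -- its own removal, which `Removable` bounds separately.
  errors : ∀ {S} → Bool → Peel N S → Fin n → ℕ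
  errors c (done _) x = 0
  errors c (step b y _ _ p) x =
    if does (x Fin.≟ y) then 0 else ⟦ does (b ≟ c) ∧ wrong b y x ⟧ + errors c p x

  module _ (c : Bool) where
    open Nest (side N c)

    private
      exclusive : Pred n → Fin n → Fin n → Pred n
      exclusive S x w z = S z ∧ (a w z ∧ not (a x z))

      -- `W` stays fixed while `S` shrinks, so this quantity never increases during the peeling.
      potential : Pred n → Fin n → Pred n → ℕ
      potential W x S = ∑[ w < n ] (⟦ W w ⟧ * # (exclusive S x w))

      exclusive-∖ : ∀ S y x w → exclusive (S ∖ y) x w ⊆ exclusive S x w
      exclusive-∖ S y x w {z} h = ∧-true (∖⊆ {S = S} (∧-conicalˡ _ _ h)) (∧-conicalʳ ((S ∖ y) z) _ h)

    -- A wrong removal of y destroys the pair (v , y) counted by the potential, v being the lowest vertex.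
    errors-potential : ∀ W {S x} (p : Peel N S) → x ∈ S → (∀ {w} → w ∈ S → w ≼ x → w ∈ W) →
                       errors c p x ≤ potential W x S
    errors-potential W (done _) x∈S below = z≤n
    errors-potential W {S} {x} (step b y y∈S r p) x∈S below with x Fin.≟ y
    ... | yes _ = z≤n
    ... | no x≢y = go r
      where
      later : errors c p x ≤ potential W x (S ∖ y)
      later = errors-potential W p (∈-∖ {S = S} x∈S x≢y) (λ w∈ → below (∖⊆ {S = S} w∈))

      shrink : ∀ w → ⟦ W w ⟧ * # (exclusive (S ∖ y) x w) ≤ ⟦ W w ⟧ * # (exclusive S x w)
      shrink w = *-monoʳ-≤ ⟦ W w ⟧ (#-mono (exclusive-∖ S y x w))

      go : Removable (side N b) S y → ⟦ does (b ≟ c) ∧ wrong b y x ⟧ + errors c p x ≤ potential W x S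
      go r with b ≟ c
      ... | no _ = ≤-trans later (∑-mono shrink)
      ... | yes refl with a y x in eq
      ...   | true  = ≤-trans later (∑-mono shrink)
      ...   | false with ((v , v∈S , vy , v≼) , _) ← r = ≤-trans (s≤s later) (∑-mono-< shrink v strict)
        where
        strict : ⟦ W v ⟧ * # (exclusive (S ∖ y) x v) < ⟦ W v ⟧ * # (exclusive S x v)
        strict rewrite below v∈S (v≼ x∈S) = *-monoʳ-< 1 (#-mono-< (exclusive-∖ S y x v)
          (∧-true y∈S (∧-true vy (cong not (trans (a-sym x y) eq))))
          (cong (_∧ (a v y ∧ not (a x y))) (∖-self S y)))

    -- Let `W` consist of the remaining vertices below `x`. A `y` in `Y` has at most `2 * D`
    -- non-neighbours in `W`. A `w` in `W` has at most `D` neighbours in `Y`, because all of `Y`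
    -- misses `x`. As `Y` has at least `2 * D` elements, `W` has at most `4 * D`, and each of them
    -- adds at most `D` to the potential.
    errors-late : ∀ {S x} (p : Peel N S) (Y : Pred n) → x ∈ S → 2 * D ≤ # Y → .{{NonZero D}} →
                  (∀ {y} → y ∈ Y → S y ≡ false × a y x ≡ false × # (λ z → S z ∧ not (a y z)) ≤ 2 * D) →
                  errors c p x ≤ 4 * D * D
    errors-late {S} {x} p Y x∈S 2D≤#Y Y-wrong = begin
      errors c p x       ≤⟨ errors-potential W p x∈S (λ {w} w∈S w≼x → ∧-true w∈S (dec-true (w ≼? x) w≼x)) ⟩
      potential W x S    ≤⟨ ∑-⟦⟧*-≤ W (λ w → # (exclusive S x w)) D (λ {w} w∈W → ≤-trans (#-mono λ {z} → ∧-conicalʳ (S z) _) (nested (≼x w∈W))) ⟩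
      # W * D            ≤⟨ *-monoˡ-≤ D #W≤4D ⟩
      4 * D * D          ∎
      where
      open ≤-Reasoning
      W : Pred n
      W w = S w ∧ does (w ≼? x)

      ≼x : ∀ {w} → w ∈ W → w ≼ x
      ≼x {w} w∈W with w ≼? x | ∧-conicalʳ (S w) _ w∈W
      ... | yes w≼x | _ = w≼x

      rows : ∀ {y} → y ∈ Y → # (λ w → W w ∧ not (a y w)) ≤ 2 * D
      rows {y} y∈Y = ≤-trans
        (#-mono λ {w} h → ∧-true (∧-conicalˡ (S w) _ (∧-conicalˡ (W w) _ h)) (∧-conicalʳ (W w) _ h))
        (proj₂ (proj₂ (Y-wrong y∈Y)))

      columns : ∀ {w} → w ∈ W → # (λ y → Y y ∧ not (not (a y w))) ≤ D
      columns {w} w∈W = ≤-trans (#-mono λ {y} h → ∧-true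
          (trans (a-sym w y) (trans (sym (not-involutive _)) (∧-conicalʳ (Y y) _ h)))
          (cong not (trans (a-sym x y) (proj₁ (proj₂ (Y-wrong (∧-conicalˡ (Y y) _ h)))))))
        (nested (≼x w∈W))

      arith : ∀ p q → 2 * D ≤ p → p * q ≤ p * (2 * D) + q * D → p * q ≤ p * (4 * D)
      -- Doubling the inequality turns `q * D` into `2 * D * q`, which `p * q` absorbs.
      arith p q 2D≤p h = +-cancelʳ-≤ (p * q) _ _ (begin
        p * q + p * q                        ≤⟨ +-mono-≤ h h ⟩
        (p * (2 * D) + q * D) + (p * (2 * D) + q * D)   ≡⟨ e p q D ⟩
        p * (4 * D) + 2 * D * q              ≤⟨ +-monoʳ-≤ (p * (4 * D)) (*-monoˡ-≤ q 2D≤p) ⟩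
        p * (4 * D) + p * q                  ∎)
        where
        e : ∀ p q D → (p * (2 * D) + q * D) + (p * (2 * D) + q * D) ≡ p * (4 * D) + 2 * D * q
        e = solve-∀

      #W≤4D : # W ≤ 4 * D
      -- Since `D` is positive, `Y` is nonempty and its size can be cancelled.
      #W≤4D = *-cancelˡ-≤ (# Y) {{>-nonZero (<-≤-trans (*-monoʳ-< 2 {x = 0} (>-nonZero⁻¹ D)) 2D≤#Y)}}
        (arith (# Y) (# W) 2D≤#Y (double-count Y W (λ y w → not (a y w)) (2 * D) D rows columns))

    -- `Y` collects the wrong removals seen so far and `k` is the number still to be collected
    -- before `errors-late` applies. Each wrong removal costs one error and lowers `k` by one. The
    -- conditions on `Y` survive further removals because `S` only shrinks.
    errors-early : ∀ {S x} k (p : Peel N S) (Y : Pred n) → x ∈ S → 2 * D ≤ # Y + k → .{{NonZero D}} →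
                   (∀ {y} → y ∈ Y → S y ≡ false × a y x ≡ false × # (λ z → S z ∧ not (a y z)) ≤ 2 * D) →
                   errors c p x ≤ k + 4 * D * D
    errors-early zero p Y x∈S 2D≤ Y-wrong =
      errors-late p Y x∈S (subst (2 * D ≤_) (+-identityʳ _) 2D≤) Y-wrong
    errors-early (suc k) (done _) Y x∈S 2D≤ Y-wrong = z≤n
    errors-early {S} {x} (suc k) (step b y y∈S r p) Y x∈S 2D≤ Y-wrong with x Fin.≟ y
    ... | yes _ = z≤n
    ... | no x≢y = go r
      where
      x∈S∖y : x ∈ S ∖ y
      x∈S∖y = ∈-∖ {S = S} x∈S x≢y

      ∉∖ : ∀ {z} → S z ≡ false → (S ∖ y) z ≡ false
      ∉∖ {z} z∉S = cong (_∧ not (does (z Fin.≟ y))) z∉S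

      smaller : ∀ {y′} → # (λ z → S z ∧ not (a y′ z)) ≤ 2 * D → # (λ z → (S ∖ y) z ∧ not (a y′ z)) ≤ 2 * D
      smaller = ≤-trans (#-mono λ {z} h → ∧-true (∖⊆ {S = S} (∧-conicalˡ _ _ h)) (∧-conicalʳ ((S ∖ y) z) _ h))

      skip : errors c p x ≤ suc k + 4 * D * D
      skip = errors-early (suc k) p Y x∈S∖y 2D≤ λ y′∈Y →
        let y′∉S , y′x , small = Y-wrong y′∈Y in ∉∖ y′∉S , y′x , smaller small

      go : Removable (side N b) S y → ⟦ does (b ≟ c) ∧ wrong b y x ⟧ + errors c p x ≤ suc k + 4 * D * D
      go r with b ≟ c
      ... | no _ = skip
      ... | yes refl with a y x in eq
      ...   | true  = skip
      ...   | false = s≤s (errors-early k p (insert Y y) x∈S∖y more λ {y′} y′∈ → new (insert⁻ Y y {y′} y′∈))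
        where
        -- Members of `Y` have left `S`, while `y` is still in it; so the insertion really enlarges
        -- `Y`.
        y∉Y : Y y ≡ false
        y∉Y with Y y in eqY
        ... | false = refl
        ... | true  = contradiction (trans (sym y∈S) (proj₁ (Y-wrong eqY))) λ ()

        more : 2 * D ≤ # (insert Y y) + k
        more = ≤-trans 2D≤ (≤-trans (≤-reflexive (+-suc (# Y) k))
          (+-monoˡ-≤ k (#-mono-< (λ {z} → ⊆insert Y y {z}) (∈insert Y y) y∉Y)))

        new : ∀ {y′} → y′ ∈ Y ⊎ y′ ≡ y →
              (S ∖ y) y′ ≡ false × a y′ x ≡ false × # (λ z → (S ∖ y) z ∧ not (a y′ z)) ≤ 2 * D
        new (inj₁ y′∈Y) = let y′∉S , y′x , small = Y-wrong y′∈Y in ∉∖ y′∉S , y′x , smaller small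
        new (inj₂ refl) = ∖-self S y , eq , smaller (proj₂ r)

    errors-bound : ∀ {S x} (p : Peel N S) → x ∈ S → .{{NonZero D}} → errors c p x ≤ 2 * D + 4 * D * D
    errors-bound p x∈S = errors-early (2 * D) p (λ _ → false) x∈S (m≤n+m (2 * D) (# {n} λ _ → false)) λ ()

  -- Follow the peeling until `x` goes. Each earlier removal adds at most one disagreement, recorded
  -- as an error of its type; at the removal of `x` all remaining pairs get the same value, which is
  -- false for at most `2 * D` of them.
  difference-errors : (∀ v → Nest.a N v v ≡ false) → ∀ {S x} (p : Peel N S) → x ∈ S →
    # (λ z → S z ∧ (Nest.a N x z xor threshold p x z)) ≤ 2 * D + (errors true p x + errors false p x)
  difference-errors irr {S} {x} (done ∅) x∈S = contradiction (trans (sym x∈S) (∅ x)) λ ()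
  difference-errors irr {S} {x} (step b y y∈S r p) x∈S with x Fin.≟ y
  ... | yes refl = ≤-trans (#-mono λ {z} → own b z) (≤-trans (proj₂ r) (m≤m+n (2 * D) 0))
    where
    open Nest N
    own : ∀ b z → S z ∧ (a y z xor (if not (does (z Fin.≟ y)) then b else threshold p y z)) ≡ true →
          S z ∧ not (Nest.a (side N b) y z) ≡ true
    own b z h with z Fin.≟ y
    -- On the diagonal both relations are false, hence agree.
    own b z h | yes refl rewrite irr y | threshold-irrefl p y = contradiction (∧-conicalʳ (S y) _ h) λ ()
    own true  z h | no _ = trans (cong (S z ∧_) (sym (trans (xor-comm (a y z) true) refl))) h
    own false z h | no _ = trans (cong (S z ∧_) (trans (not-involutive _) (sym (xor-identityʳ (a y z))))) h
  ... | no x≢y = begin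
    # (λ z → S z ∧ (a x z xor (if does (z Fin.≟ y) then b else threshold p x z)))
      ≤⟨ #-mono-except _ (λ z → (S ∖ y) z ∧ (a x z xor threshold p x z)) y off ⟩
    ⟦ S y ∧ (a x y xor (if does (y Fin.≟ y) then b else threshold p x y)) ⟧
      + # (λ z → (S ∖ y) z ∧ (a x z xor threshold p x z))
      ≤⟨ +-mono-≤ (at b) (difference-errors irr p (∈-∖ {S = S} x∈S x≢y)) ⟩
    (⟦ does (b ≟ true) ∧ wrong b y x ⟧ + ⟦ does (b ≟ false) ∧ wrong b y x ⟧)
      + (2 * D + (errors true p x + errors false p x))
      ≡⟨ e ⟦ does (b ≟ true) ∧ wrong b y x ⟧ ⟦ does (b ≟ false) ∧ wrong b y x ⟧ (2 * D) (errors true p x) (errors false p x) ⟩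
    2 * D + ((⟦ does (b ≟ true) ∧ wrong b y x ⟧ + errors true p x)
      + (⟦ does (b ≟ false) ∧ wrong b y x ⟧ + errors false p x)) ∎
    where
    open Nest N
    open ≤-Reasoning
    off : ∀ {z} → z ≢ y → S z ∧ (a x z xor (if does (z Fin.≟ y) then b else threshold p x z)) ≡ true →
          (S ∖ y) z ∧ (a x z xor threshold p x z) ≡ true
    off {z} z≢y h with z Fin.≟ y
    ... | yes z≡y = contradiction z≡y z≢y
    ... | no  _   = ∧-true (∧-true (∧-conicalˡ (S z) _ h) refl) (∧-conicalʳ (S z) _ h)

    -- Only the summand for the actual type `b` can be nonzero.
    at : ∀ b → ⟦ S y ∧ (a x y xor (if does (y Fin.≟ y) then b else threshold p x y)) ⟧ ≤
               ⟦ does (b ≟ true) ∧ wrong b y x ⟧ + ⟦ does (b ≟ false) ∧ wrong b y x ⟧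
    at true  rewrite y∈S | dec-true (y Fin.≟ y) refl | a-sym x y with a y x
    ... | true  = z≤n
    ... | false = s≤s z≤n
    at false rewrite y∈S | dec-true (y Fin.≟ y) refl | a-sym x y with a y x
    ... | true  = s≤s z≤n
    ... | false = z≤n

    e : ∀ i j k l m → (i + j) + (k + (l + m)) ≡ k + ((i + l) + (j + m))
    e = solve-∀

-- Graphs

opaque
  unfolding #

  ∣∣≡# : (p : Subset n) → ∣ p ∣ ≡ # (lookup p)
  ∣∣≡# []          = refl
  ∣∣≡# (true  ∷ p) = cong suc (∣∣≡# p)
  ∣∣≡# (false ∷ p) = ∣∣≡# p

  #-cong : {p q : Pred n} → (∀ i → p i ≡ q i) → # p ≡ # q
  #-cong p≗q = sum-cong-≗ λ i → cong ⟦_⟧ (p≗q i)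

lookup-─ : ∀ (p q : Subset n) i → lookup (p ─ q) i ≡ lookup p i ∧ not (lookup q i)
lookup-─ (x ∷ p) (true  ∷ q) zero    = sym (∧-zeroʳ x)
lookup-─ (x ∷ p) (false ∷ q) zero    = sym (∧-identityʳ x)
lookup-─ (x ∷ p) (y     ∷ q) (suc i) = lookup-─ p q i

lookup-⁅⁆ : ∀ (x i : Fin n) → lookup ⁅ x ⁆ i ≡ does (i Fin.≟ x)
lookup-⁅⁆ zero    zero    = refl
lookup-⁅⁆ zero    (suc i) = lookup-replicate i false
lookup-⁅⁆ (suc x) zero    = refl
lookup-⁅⁆ (suc x) (suc i) = lookup-⁅⁆ x i

module _ (G : Graph n) where

  ∣N─N∣ : ∀ (H : Graph n) u v → ∣ neighbours G u ─ neighbours H v ∣ ≡ # (λ z → adj G u z ∧ not (adj H v z))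
  ∣N─N∣ H u v = trans (∣∣≡# (neighbours G u ─ neighbours H v)) (#-cong λ z → trans
    (lookup-─ (neighbours G u) (neighbours H v) z)
    (cong₂ (λ b c → b ∧ not c) (lookup∘tabulate (adj G u) z) (lookup∘tabulate (adj H v) z)))

  private
    outside : Fin n → Fin n → Fin n → Bool
    outside u v z = ((adj G v z ∧ not (adj G u z)) ∧ not (does (z Fin.≟ u))) ∧ not (does (z Fin.≟ v))

  ∣N─N-u-v∣ : ∀ u v → ∣ neighbours G v ─ neighbours G u - u - v ∣ ≡ # (outside u v)
  ∣N─N-u-v∣ u v = trans (∣∣≡# (neighbours G v ─ neighbours G u - u - v)) (#-cong λ z →
    trans (lookup-─ (neighbours G v ─ neighbours G u - u) ⁅ v ⁆ z) (cong₂ (λ b c → b ∧ not c)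
      (trans (lookup-─ (neighbours G v ─ neighbours G u) ⁅ u ⁆ z) (cong₂ (λ b c → b ∧ not c)
        (trans (lookup-─ (neighbours G v) (neighbours G u) z) (cong₂ (λ b c → b ∧ not c)
          (lookup∘tabulate (adj G v) z) (lookup∘tabulate (adj G u) z)))
        (lookup-⁅⁆ u z)))
      (lookup-⁅⁆ v z)))

  -- The additional 2 pays for `u` and `v`, which domination leaves out of the count. This is where
  -- `D = 2 + t` comes from.
  dominates⇒ : ∀ {t u v} → Dominates G t u v → # (λ z → adj G v z ∧ not (adj G u z)) ≤ 2 + t
  dominates⇒ {t} {u} {v} dom = begin
    # (λ z → adj G v z ∧ not (adj G u z))
      ≤⟨ remove _ u ⟩
    1 + # (λ z → (adj G v z ∧ not (adj G u z)) ∧ not (does (z Fin.≟ u)))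
      ≤⟨ +-monoʳ-≤ 1 (remove _ v) ⟩
    2 + # (outside u v)
      ≡⟨ cong (2 +_) (∣N─N-u-v∣ u v) ⟨
    2 + ∣ neighbours G v ─ neighbours G u - u - v ∣
      ≤⟨ +-monoʳ-≤ 2 dom ⟩
    2 + t ∎
    where
    open ≤-Reasoning
    remove : ∀ (p : Pred n) y → # p ≤ 1 + # (p ∖ y)
    remove p y = ≤-trans (#-mono-except p (p ∖ y) y λ z≢y z∈p → ∈-∖ {S = p} z∈p z≢y) (+-monoˡ-≤ _ (⟦⟧≤1 (p y)))

  nested⇒dominates : ∀ {u v} → (∀ w → w ≢ u → w ≢ v → adj G v w ≡ true → adj G u w ≡ true) → Dominates G 0 u v
  nested⇒dominates {u} {v} sub = ≤-reflexive (trans (∣N─N-u-v∣ u v) (#-empty empty))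
    where
    empty : ∀ z → outside u v z ≡ false
    empty z with z Fin.≟ u | z Fin.≟ v | adj G v z in eqv | adj G u z in equ
    ... | yes _  | _      | b     | c     = cong (_∧ _) (∧-zeroʳ (b ∧ not c))
    ... | no _   | yes _  | b     | c     = ∧-zeroʳ _
    ... | no z≢u | no z≢v | false | _     = refl
    ... | no z≢u | no z≢v | true  | true  = refl
    ... | no z≢u | no z≢v | true  | false = contradiction (trans (sym equ) (sub z z≢u z≢v eqv)) λ ()

  -- Both differences leave the same common part, so the smaller neighbourhood has the smaller excess.
  excess-mono : ∀ {w x} → # (adj G w) ≤ # (adj G x) →
                # (λ z → adj G w z ∧ not (adj G x z)) ≤ # (λ z → adj G x z ∧ not (adj G w z))
  excess-mono {w} {x} dw≤dx = +-cancelˡ-≤ (# (λ z → adj G w z ∧ adj G x z)) _ _ (begin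
    # (λ z → adj G w z ∧ adj G x z) + # (λ z → adj G w z ∧ not (adj G x z))
      ≡⟨ #-split (adj G w) (adj G x) ⟨
    # (adj G w)
      ≤⟨ dw≤dx ⟩
    # (adj G x)
      ≡⟨ #-split (adj G x) (adj G w) ⟩
    # (λ z → adj G x z ∧ adj G w z) + # (λ z → adj G x z ∧ not (adj G w z))
      ≡⟨ cong (_+ # (λ z → adj G x z ∧ not (adj G w z))) (#-cong λ z → ∧-comm (adj G x z) (adj G w z)) ⟩
    # (λ z → adj G w z ∧ adj G x z) + # (λ z → adj G x z ∧ not (adj G w z)) ∎)
    where open ≤-Reasoning

  -- Comparing degrees gives a total preorder. If domination goes against it, so that `w` dominates
  -- `x` of larger or equal degree, `excess-mono` carries the bound over to the other difference.
  degree-nest : ∀ {t} → Dominating t G → Nest n (2 + t)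
  degree-nest {t} dom = record
    { a       = adj G
    ; a-sym   = Graph.sym G
    ; _≼_     = λ w x → # (adj G w) ≤ # (adj G x)
    ; ≼-total = λ w x → ≤-total (# (adj G w)) (# (adj G x))
    ; ≼-trans = ≤-trans
    ; _≼?_    = λ w x → # (adj G w) ≤? # (adj G x)
    ; nested  = λ {w} {x} → nested w x
    }
    where
    nested : ∀ w x → # (adj G w) ≤ # (adj G x) → # (λ z → adj G w z ∧ not (adj G x z)) ≤ 2 + t
    nested w x dw≤dx with w Fin.≟ x
    ... | yes refl = ≤-trans (≤-reflexive (#-empty λ z → ∧-inverseʳ (adj G w z))) z≤n
    ... | no w≢x with dom x w (w≢x ∘ sym)
    ...   | inj₁ x≥w = dominates⇒ x≥w
    ...   | inj₂ w≥x = ≤-trans (excess-mono dw≤dx) (dominates⇒ w≥x)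

localDifference-≤ : ∀ (G H : Graph n) B → (∀ v → # (λ z → adj G v z xor adj H v z) ≤ B) → localDifference G H ≤ B
-- `z≤n` handles the default value 0 of the maximum.
localDifference-≤ {n} G H B h = max≤v⁺ z≤n (map⁺ (tabulate⁺ {n = n} bound))
  where
  bound : ∀ v → ∣ neighbours G v ─ neighbours H v ∣ + ∣ neighbours H v ─ neighbours G v ∣ ≤ B
  bound v = begin
    ∣ neighbours G v ─ neighbours H v ∣ + ∣ neighbours H v ─ neighbours G v ∣
      ≡⟨ cong₂ _+_ (∣N─N∣ G H v v) (∣N─N∣ H G v v) ⟩
    # (λ z → adj G v z ∧ not (adj H v z)) + # (λ z → adj H v z ∧ not (adj G v z))
      -- The two one-sided differences are the symmetric difference split by adjacency to `v` in
      -- `G`.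
      ≡⟨ cong₂ _+_ (#-cong λ z → left (adj G v z) (adj H v z)) (#-cong λ z → right (adj G v z) (adj H v z)) ⟩
    # (λ z → (adj G v z xor adj H v z) ∧ adj G v z) + # (λ z → (adj G v z xor adj H v z) ∧ not (adj G v z))
      ≡⟨ #-split (λ z → adj G v z xor adj H v z) (adj G v) ⟨
    # (λ z → adj G v z xor adj H v z)
      ≤⟨ h v ⟩
    B ∎
    where
    open ≤-Reasoning
    left : ∀ b c → b ∧ not c ≡ (b xor c) ∧ b
    left true  c     = sym (∧-identityʳ (not c))
    left false true  = refl
    left false false = refl
    right : ∀ b c → c ∧ not b ≡ (b xor c) ∧ not b
    right true  c = trans (∧-zeroʳ c) (sym (∧-zeroʳ (not c)))
    right false c = refl

threshold-dominating : ∀ {D} {N : Nest n D} {S} (p : Peel N S) → Dominating 0 (threshold-graph p)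
threshold-dominating p u v u≢v with threshold-nested p u≢v
... | inj₁ h = inj₁ (nested⇒dominates (threshold-graph p) h)
... | inj₂ h = inj₂ (nested⇒dominates (threshold-graph p) λ w w≢v w≢u → h w w≢u w≢v)

-- Numerical bound and conclusion

-- The first `2 * D` comes from the vertex's own removal, the two brackets from tops and bottoms.
-- For positive `t` one has `D ≤ 3 * t`, so the sum is at most `18 * t + 72 * t ^ 2`, hence at most
-- `90 * t ^ 4`.
total-error-≤ : ∀ s → let t = suc s ; D = 2 + t in
          2 * D + ((2 * D + 4 * D * D) + (2 * D + 4 * D * D)) ≤ 646 * t ^ 4
total-error-≤ s = begin
  2 * D + ((2 * D + 4 * D * D) + (2 * D + 4 * D * D))  ≤⟨ mono (+-mono-≤ (*-monoʳ-≤ 2 (s≤s (z≤n {s}))) ≤-refl) ⟩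
  f (2 * t + t)                                        ≡⟨ expand t ⟩
  18 * t ^ 1 + 72 * t ^ 2                              ≤⟨ +-mono-≤ (*-monoʳ-≤ 18 (^-monoʳ-≤ t (m≤m+n 1 3))) (*-monoʳ-≤ 72 (^-monoʳ-≤ t (m≤m+n 2 2))) ⟩
  18 * t ^ 4 + 72 * t ^ 4                              ≡⟨ *-distribʳ-+ (t ^ 4) 18 72 ⟨
  90 * t ^ 4                                           ≤⟨ *-monoˡ-≤ (t ^ 4) (m≤m+n 90 556) ⟩
  646 * t ^ 4 ∎
  where
  open ≤-Reasoning
  t = suc s
  D = 2 + t
  f : ℕ → ℕ
  f d = 2 * d + ((2 * d + 4 * d * d) + (2 * d + 4 * d * d))
  expand : ∀ t → 2 * (2 * t + t) + ((2 * (2 * t + t) + 4 * (2 * t + t) * (2 * t + t)) + (2 * (2 * t + t) + 4 * (2 * t + t) * (2 * t + t)))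
               ≡ 18 * (t * 1) + 72 * (t * (t * 1))
  expand = solve-∀
  mono : ∀ {d e} → d ≤ e → f d ≤ f e
  mono d≤e = +-mono-≤ (*-monoʳ-≤ 2 d≤e) (+-mono-≤ g g)
    where g = +-mono-≤ (*-monoʳ-≤ 2 d≤e) (*-mono-≤ (*-monoʳ-≤ 4 d≤e) d≤e)

mainTheorem1 : ∀ (t n : ℕ) (G : Graph n) → Dominating t G → Σ[ H ∈ Graph n ] (Dominating 0 H × localDifference G H ≤ 646 * t ^ 4)
-- For `t = 0` the bound is 0, which forces `H` to be `G`.
mainTheorem1 zero n G dom =
  G , dom , localDifference-≤ G G 0 λ v → ≤-reflexive (#-empty λ z → xor-same (adj G v z))
-- The peeling starts from the full vertex set, so every membership is `refl` and the count in
-- `difference-errors` covers all vertices.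
mainTheorem1 t@(suc s) n G dom = threshold-graph p , threshold-dominating p ,
  localDifference-≤ G (threshold-graph p) _ λ v → begin
    # (λ z → adj G v z xor threshold p v z)                    ≤⟨ difference-errors (Graph.irrefl G) p refl ⟩
    2 * D + (errors true p v + errors false p v)               ≤⟨ +-monoʳ-≤ (2 * D) (+-mono-≤ (errors-bound true p refl) (errors-bound false p refl)) ⟩
    2 * D + ((2 * D + 4 * D * D) + (2 * D + 4 * D * D))        ≤⟨ total-error-≤ s ⟩
    646 * t ^ 4                                                ∎
  where
  open ≤-Reasoning
  D = 2 + t
  p : Peel (degree-nest G dom) (λ _ → true)
  p = peel (degree-nest G dom) (λ _ → true)
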